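{- Let $c_2>1$ be a constant and consider an improving multi-armed bandits instance with $k$ arms and horizon $T\ge 2k$. If $m\in\left[\tfrac{1}{c_2}f^\star(T-k),\,f^\star(T-k)\right]$, then the Random Round Robin algorithm, run with threshold parameter $m$ and time parameter $\tau=T-k$, receives expected reward at least $\dfrac{OPT_T}{8\,c_2\sqrt{k}}$ in $T$ steps.
   Context: An instance of the improving multi-armed bandits problem consists of $k$ arms; arm $i$ has a reward function $f_i:\{0,1,2,\dots\}\to\mathbb{R}_{\ge 0}$ that is nondecreasing, satisfies $f_i(0)=0$, and has diminishing returns: $f_i(t+1)-f_i(t)\le f_i(t)-f_i(t-1)$ for all $t\ge 1$. Pulling arm $i$ for the $t$-th time yields reward $f_i(t)$. $OPT_T=\max_i\sum_{t=1}^T f_i(t)$, and $f^\star$ denotes the reward function of an arm attaining this maximum. Random Round Robin with parameters $m,\tau$: repeatedly choose an arm $i$ uniformly at random among the arms not chosen so far, set its pull counter $t_i=0$, and keep pulling it (each pull increases $t_i$ by one and collects reward $f_i(t_i)$) as long as $f_i(t_i)\ge m\,t_i/\tau$; when this test first fails, abandon arm $i$ for good and choose a new arm. The algorithm stops when the allotted total number of pulls ($T$ in the claim) has been made (or no arm remains). Its reward is the sum of all rewards collected; expectation is over its random choices. -}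

module Defs where

open import Level using (Level; _⊔_) renaming (suc to lsuc)
open import Data.Nat.Base as ℕ using (ℕ; zero; suc)
open import Data.Fin.Base using (Fin; toℕ)
open import Data.Product.Base using (_×_; _,_)
open import Data.List.Base as List using (List; []; _∷_)
open import Data.Vec.Base as Vec using (Vec; []; _∷_; lookup; removeAt)
open import Relation.Nullary.Decidable.Core using (yes; no)
open import Relation.Nullary.Negation.Core using (¬_)
open import Relation.Binary.Core using (Rel)
open import Relation.Binary.Bundles using (DecTotalOrder)
open import Relation.Binary.Structures using (IsDecTotalOrder)
open import Algebra.Bundles using (CommutativeRing)
import Algebra.Properties.CommutativeMonoid.Sum
import Algebra.Properties.Semiring.Mult
import Data.List.Extrema
import Relation.Binary.Properties.DecTotalOrder

-- Ordered fields with decidable order in which nonnegative elements have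
-- square roots.  They play the role of ℝ, which (classically) is one of them;
-- a result for all Euclidean fields is in particular a result about ℝ.
-- `_⁻¹` and `√_` are total functions whose values are unspecified at 0
-- and at negative arguments respectively.
record EuclideanField c ℓ₁ ℓ₂ : Set (lsuc (c ⊔ ℓ₁ ⊔ ℓ₂)) where
  field
    commutativeRing : CommutativeRing c ℓ₁

  open CommutativeRing commutativeRing public hiding (zero)

  infix  4 _≤_
  infix  8 _⁻¹
  infix  8 √_
  field
    _≤_             : Rel Carrier ℓ₂
    isDecTotalOrder : IsDecTotalOrder _≈_ _≤_
    +-monoˡ-≤       : ∀ z {x y} → x ≤ y → x + z ≤ y + z
    *-nonneg        : ∀ {x y} → 0# ≤ x → 0# ≤ y → 0# ≤ x * y

    0≉1             : ¬ (0# ≈ 1#)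
    _⁻¹             : Carrier → Carrier
    ⁻¹-inverseʳ     : ∀ {x} → ¬ (x ≈ 0#) → x * x ⁻¹ ≈ 1#

    √_              : Carrier → Carrier
    √-nonneg        : ∀ {x} → 0# ≤ x → 0# ≤ √ x
    √-square        : ∀ {x} → 0# ≤ x → √ x * √ x ≈ x

  decTotalOrder : DecTotalOrder c ℓ₁ ℓ₂
  decTotalOrder = record { isDecTotalOrder = isDecTotalOrder }

  open DecTotalOrder decTotalOrder public
    using (totalOrder; _≤?_)
  open Relation.Binary.Properties.DecTotalOrder decTotalOrder public
    using (_<_)
  open Algebra.Properties.CommutativeMonoid.Sum +-commutativeMonoid public
    using (sum-syntax)

  infixl 7 _/_
  _/_ : Carrier → Carrier → Carrier
  x / y = x * y ⁻¹

  fromℕ : ℕ → Carrier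
  fromℕ n = n Mult.× 1#
    where module Mult = Algebra.Properties.Semiring.Mult semiring

module _ {c ℓ₁ ℓ₂} (𝔽 : EuclideanField c ℓ₁ ℓ₂) where
  open EuclideanField 𝔽

  record ImprovingBandits (k : ℕ) : Set (c ⊔ ℓ₁ ⊔ ℓ₂) where
    field
      reward        : Fin k → ℕ → Carrier
      nonneg        : ∀ i t → 0# ≤ reward i t
      nondecreasing : ∀ i {s t} → s ℕ.≤ t → reward i s ≤ reward i t
      initial       : ∀ i → reward i 0 ≈ 0#
      diminishing   : ∀ i t → reward i (2 ℕ.+ t) - reward i (1 ℕ.+ t)
                            ≤ reward i (1 ℕ.+ t) - reward i t

-- Finitely supported distributions, as lists of weighted outcomes.
module Probability {c ℓ₁ ℓ₂} (𝔽 : EuclideanField c ℓ₁ ℓ₂) where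
  open EuclideanField 𝔽

  private
    variable
      a b : Level
      A : Set a
      B : Set b

  Dist : Set a → Set (a ⊔ c)
  Dist A = List (Carrier × A)

  return : A → Dist A
  return x = (1# , x) ∷ []

  infixl 1 _>>=_
  _>>=_ : Dist A → (A → Dist B) → Dist B
  d >>= g = List.concatMap (λ (p , x) → List.map (λ (q , y) → p * q , y) (g x)) d

  uniform : ∀ n → Dist (Fin n)
  uniform n = List.map (λ j → 1# / fromℕ n , j) (List.allFin n)

  expectation : Dist Carrier → Carrier
  expectation = List.foldr (λ (p , x) e → p * x + e) 0#

module Bandits {c ℓ₁ ℓ₂} (𝔽 : EuclideanField c ℓ₁ ℓ₂)
               {k : ℕ} (I : ImprovingBandits 𝔽 k) where
  open EuclideanField 𝔽
  open ImprovingBandits I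
  open Probability 𝔽

  -- The sum of f_i(t) over 1 ≤ t ≤ T.
  cumulative : Fin k → ℕ → Carrier
  cumulative i T = ∑[ t < T ] reward i (suc (toℕ t))

  -- Cumulative rewards are nonnegative, so the base value 0# of `max` is
  -- harmless.
  OPT : ℕ → Carrier
  OPT T = max 0# (List.tabulate λ i → cumulative i T)
    where open Data.List.Extrema totalOrder using (max)

  IsOptimalArm : ℕ → Fin k → Set ℓ₁
  IsOptimalArm T i = cumulative i T ≈ OPT T

  module RandomRoundRobin (m : Carrier) (τ : ℕ) where

    -- `play i t n` keeps pulling arm i, already pulled t times, with n pulls
    -- left; it returns the number of pulls left when the arm is abandoned (or
    -- the budget is exhausted) and the reward collected meanwhile.
    play : Fin k → ℕ → ℕ → ℕ × Carrier
    play i t zero    = zero , 0#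
    play i t (suc n) with (m * fromℕ t) / fromℕ τ ≤? reward i t
    ... | no  _ = suc n , 0#
    ... | yes _ = let (n′ , x) = play i (suc t) n
                  in  n′ , reward i (suc t) + x

    -- The total reward collected with n pulls left, the given arms being the
    -- ones not chosen so far.
    run : ℕ → ∀ {r} → Vec (Fin k) r → Dist Carrier
    run n       []                  = return 0#
    run zero    (_ ∷ _)             = return 0#
    run (suc n) {suc r} arms@(_ ∷ _) =
      uniform (suc r) >>= λ j →
      let (n′ , x) = play (lookup arms j) 0 (suc n) in
      run n′ (removeAt arms j) >>= λ y →
      return (x + y)

    expectedReward : ℕ → Carrier
    expectedReward T = expectation (run T (Vec.allFin k))

{-# OPTIONS --safe #-}
module Submission where

open import Defs
open import Data.Nat.Base as ℕ using (ℕ; zero; suc; z≤n; s≤s)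
import Data.Nat.Properties as ℕ
open import Data.Fin.Base using (Fin; zero; suc; toℕ; punchIn; punchOut)
open import Data.Fin.Properties using (punchInᵢ≢i)
open import Data.List.Base as List using ([]; _∷_; _++_)
open import Data.Product.Base using (∃-syntax; _×_; _,_; proj₁; proj₂)
open import Data.Sum.Base using (_⊎_; inj₁; inj₂)
open import Data.Vec.Base as Vec using (Vec; []; _∷_; lookup; removeAt)
open import Data.Vec.Properties using (lookup-allFin; removeAt-punchOut)
open import Function.Base using (id; _∘_; _$_)
open import Level using (Level)
open import Relation.Binary.Bundles using (DecTotalOrder)
open import Relation.Binary.PropositionalEquality.Core as ≡ using (_≡_; _≢_)
open import Relation.Nullary.Decidable.Core using (yes; no)
open import Relation.Nullary.Negation.Core using (contradiction)
import Algebra.Properties.Group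
import Algebra.Properties.Ring
import Algebra.Properties.Semiring.Mult
import Algebra.Properties.Semiring.Sum
import Algebra.Solver.Ring.NaturalCoefficients.Default
import Relation.Binary.Reasoning.PartialOrder

-- Write θ = m/τ and q(x) = x(x+1). By concavity OPT_T ≤ (2τ+1) f⋆(τ), as T ≤ 2τ,
-- so it suffices that the expected reward is at least θ q(τ) / (4√k). More
-- generally, with n pulls and r arms left, the optimal one among them, and
-- x = n ∸ r ≤ τ, the expected reward V(x, r) is at least θ q(x) / (4√r). This goes
-- by induction on r, without any analysis of the random order. An arm abandoned
-- after ℓ+1 pulls yields at least θ q(ℓ)/2 and lowers x by at most ℓ, and the
-- optimal arm passes every test up to τ, so it yields at least θ q(x)/2. With
-- s = √(r-1), minimising q(ℓ)/2 + q(x-ℓ)/(4s) over ℓ shows that every other arm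
-- contributes at least θ q(x) / (4(s+1)), and averaging over the r choices gives
-- V(x, r) ≥ θ q(x) (s+1)² / (4(s+1)r) ≥ θ q(x) / (4√r), since √r ≤ s+1.

-- Arithmetic in ordered fields.

module OrderedField {c ℓ₁ ℓ₂} (𝔽 : EuclideanField c ℓ₁ ℓ₂) where
  open EuclideanField 𝔽
  open DecTotalOrder decTotalOrder public using (poset)
    renaming ( refl to ≤-refl; reflexive to ≤-reflexive; trans to ≤-trans
             ; antisym to ≤-antisym; total to ≤-total )
  open Relation.Binary.Reasoning.PartialOrder poset
  open Algebra.Properties.Ring ring using (-‿distribˡ-*)
  open Algebra.Properties.Group +-group using (⁻¹-involutive)
  open Algebra.Properties.Semiring.Mult semiring using (×-homo-+; ×1-homo-*)
  open Algebra.Properties.Semiring.Sum semiring using (sum)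
  open Algebra.Solver.Ring.NaturalCoefficients.Default commutativeSemiring public
    using (solve; _:=_; con; _:+_; _:*_)

  2# 4# : Carrier
  2# = 1# + 1#
  4# = 2# * 2#

  +-monoʳ-≤ : ∀ z {x y} → x ≤ y → z + x ≤ z + y
  +-monoʳ-≤ z {x} {y} x≤y = begin
    z + x ≈⟨ +-comm z x ⟩
    x + z ≤⟨ +-monoˡ-≤ z x≤y ⟩
    y + z ≈⟨ +-comm y z ⟩
    z + y ∎

  +-mono-≤ : ∀ {x y u v} → x ≤ y → u ≤ v → x + u ≤ y + v
  +-mono-≤ {y = y} {u = u} x≤y u≤v = ≤-trans (+-monoˡ-≤ u x≤y) (+-monoʳ-≤ y u≤v)

  +-nonneg : ∀ {x y} → 0# ≤ x → 0# ≤ y → 0# ≤ x + y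
  +-nonneg 0≤x 0≤y = ≤-trans (≤-reflexive (sym (+-identityˡ 0#))) (+-mono-≤ 0≤x 0≤y)

  x≤x+y : ∀ x {y} → 0# ≤ y → x ≤ x + y
  x≤x+y x 0≤y = ≤-trans (≤-reflexive (sym (+-identityʳ x))) (+-monoʳ-≤ x 0≤y)

  x≤y+x : ∀ x {y} → 0# ≤ y → x ≤ y + x
  x≤y+x x 0≤y = ≤-trans (≤-reflexive (sym (+-identityˡ x))) (+-monoˡ-≤ x 0≤y)

  -- Replacing an inequality by an equation with a nonnegative gap makes later estimates accessible
  -- to the commutative semiring solver, which knows no subtraction.
  ≤⇒∃+ : ∀ {x y} → x ≤ y → ∃[ d ] (0# ≤ d × x + d ≈ y)
  ≤⇒∃+ {x} {y} x≤y = y - x , 0≤d , x+d≈y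
    where
    0≤d : 0# ≤ y - x
    0≤d = ≤-trans (≤-reflexive (sym (-‿inverseʳ x))) (+-monoˡ-≤ (- x) x≤y)
    x+d≈y : x + (y - x) ≈ y
    x+d≈y = begin-equality
      x + (y - x)   ≈⟨ +-comm x (y - x) ⟩
      (y - x) + x   ≈⟨ +-assoc y (- x) x ⟩
      y + (- x + x) ≈⟨ +-congˡ (-‿inverseˡ x) ⟩
      y + 0#        ≈⟨ +-identityʳ y ⟩
      y             ∎

  +-cancelʳ-≤ : ∀ z {x y} → x + z ≤ y + z → x ≤ y
  +-cancelʳ-≤ z {x} {y} x+z≤y+z = begin
    x             ≈⟨ [x+z]-z≈x x ⟨
    (x + z) - z   ≤⟨ +-monoˡ-≤ (- z) x+z≤y+z ⟩
    (y + z) - z   ≈⟨ [x+z]-z≈x y ⟩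
    y             ∎
    where
    [x+z]-z≈x : ∀ x → (x + z) - z ≈ x
    [x+z]-z≈x x = begin-equality
      (x + z) - z   ≈⟨ +-assoc x z (- z) ⟩
      x + (z - z)   ≈⟨ +-congˡ (-‿inverseʳ z) ⟩
      x + 0#        ≈⟨ +-identityʳ x ⟩
      x             ∎

  *-monoʳ-≤ : ∀ {z x y} → 0# ≤ z → x ≤ y → z * x ≤ z * y
  *-monoʳ-≤ {z} {x} {y} 0≤z x≤y with d , 0≤d , x+d≈y ← ≤⇒∃+ x≤y = begin
    z * x           ≤⟨ x≤x+y (z * x) (*-nonneg 0≤z 0≤d) ⟩
    z * x + z * d   ≈⟨ distribˡ z x d ⟨
    z * (x + d)     ≈⟨ *-congˡ x+d≈y ⟩
    z * y           ∎

  *-monoˡ-≤ : ∀ {z x y} → 0# ≤ z → x ≤ y → x * z ≤ y * z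
  *-monoˡ-≤ {z} {x} {y} 0≤z x≤y = begin
    x * z ≈⟨ *-comm x z ⟩
    z * x ≤⟨ *-monoʳ-≤ 0≤z x≤y ⟩
    z * y ≈⟨ *-comm z y ⟩
    y * z ∎

  -- If `1# ≤ 0#`, then `- 1#` is nonnegative, and so is its square, which is `1#`.
  0≤1 : 0# ≤ 1#
  0≤1 with ≤-total 0# 1#
  ... | inj₁ 0≤1 = 0≤1
  ... | inj₂ 1≤0 = begin
      0#              ≤⟨ *-nonneg 0≤-1 0≤-1 ⟩
      (- 1#) * (- 1#) ≈⟨ -‿distribˡ-* 1# (- 1#) ⟨
      - (1# * (- 1#)) ≈⟨ -‿cong (*-identityˡ (- 1#)) ⟩
      - (- 1#)        ≈⟨ ⁻¹-involutive 1# ⟩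
      1#              ∎
    where
    0≤-1 : 0# ≤ - 1#
    0≤-1 = begin
      0#         ≈⟨ -‿inverseʳ 1# ⟨
      1# - 1#    ≤⟨ +-monoˡ-≤ (- 1#) 1≤0 ⟩
      0# - 1#    ≈⟨ +-identityˡ (- 1#) ⟩
      - 1#       ∎

  0<1 : 0# < 1#
  0<1 = 0≤1 , 0≉1

  <-≤-trans : ∀ {x y z} → x < y → y ≤ z → x < z
  <-≤-trans {x} {y} (x≤y , x≉y) y≤z =
    ≤-trans x≤y y≤z , λ x≈z → x≉y (≤-antisym x≤y (≤-trans y≤z (≤-reflexive (sym x≈z))))

  x*x⁻¹≈1 : ∀ {x} → 0# < x → x * x ⁻¹ ≈ 1#
  x*x⁻¹≈1 (_ , 0≉x) = ⁻¹-inverseʳ (0≉x ∘ sym)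

  ⁻¹-nonneg : ∀ {x} → 0# < x → 0# ≤ x ⁻¹
  ⁻¹-nonneg {x} 0<x@(0≤x , _) with ≤-total 0# (x ⁻¹)
  ... | inj₁ 0≤x⁻¹ = 0≤x⁻¹
  ... | inj₂ x⁻¹≤0 = contradiction (≤-antisym 0≤1 1≤0) 0≉1
    where
    1≤0 : 1# ≤ 0#
    1≤0 = begin
      1#        ≈⟨ x*x⁻¹≈1 0<x ⟨
      x * x ⁻¹  ≤⟨ *-monoʳ-≤ 0≤x x⁻¹≤0 ⟩
      x * 0#    ≈⟨ zeroʳ x ⟩
      0#        ∎

  *-/-cancelʳ : ∀ {z} x → 0# < z → (x * z) / z ≈ x
  *-/-cancelʳ {z} x 0<z = begin-equality
    (x * z) / z       ≈⟨ *-assoc x z (z ⁻¹) ⟩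
    x * (z * z ⁻¹)    ≈⟨ *-congˡ (x*x⁻¹≈1 0<z) ⟩
    x * 1#            ≈⟨ *-identityʳ x ⟩
    x                 ∎

  /-*-cancelʳ : ∀ {z} x → 0# < z → x / z * z ≈ x
  /-*-cancelʳ {z} x 0<z = trans
    (solve 3 (λ x z i → x :* i :* z := x :* z :* i) refl x z (z ⁻¹))
    (*-/-cancelʳ x 0<z)

  x≤yz⇒x/z≤y : ∀ {x y z} → 0# < z → x ≤ y * z → x / z ≤ y
  x≤yz⇒x/z≤y {x} {y} {z} 0<z x≤yz = begin
    x / z         ≤⟨ *-monoˡ-≤ (⁻¹-nonneg 0<z) x≤yz ⟩
    (y * z) / z   ≈⟨ *-/-cancelʳ y 0<z ⟩
    y             ∎

  *-cancelʳ-≤ : ∀ {x y z} → 0# < z → x * z ≤ y * z → x ≤ y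
  *-cancelʳ-≤ {x} {y} {z} 0<z xz≤yz = begin
    x             ≈⟨ *-/-cancelʳ x 0<z ⟨
    (x * z) / z   ≤⟨ x≤yz⇒x/z≤y 0<z xz≤yz ⟩
    y             ∎

  *-pos : ∀ {x y} → 0# < x → 0# < y → 0# < x * y
  *-pos {x} {y} (0≤x , 0≉x) 0<y@(0≤y , _) = *-nonneg 0≤x 0≤y , λ 0≈xy → 0≉x $ begin-equality
    0#          ≈⟨ zeroˡ (y ⁻¹) ⟨
    0# / y      ≈⟨ *-congʳ 0≈xy ⟩
    (x * y) / y ≈⟨ *-/-cancelʳ x 0<y ⟩
    x           ∎

  √-pos : ∀ {x} → 0# < x → 0# < √ x
  √-pos {x} (0≤x , 0≉x) = √-nonneg 0≤x , λ 0≈√x → 0≉x $ begin-equality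
    0#        ≈⟨ zeroˡ (√ x) ⟨
    0# * √ x  ≈⟨ *-congʳ 0≈√x ⟩
    √ x * √ x ≈⟨ √-square 0≤x ⟩
    x         ∎

  -- If `y ≤ x`, then `x * x ≤ y * y ≤ y * x`, and the positive factor `x` cancels.
  x²≤y²⇒x≤y : ∀ {x y} → 0# < x → 0# ≤ y → x * x ≤ y * y → x ≤ y
  x²≤y²⇒x≤y {x} {y} 0<x 0≤y x²≤y² with ≤-total x y
  ... | inj₁ x≤y = x≤y
  ... | inj₂ y≤x = *-cancelʳ-≤ 0<x (≤-trans x²≤y² (*-monoʳ-≤ 0≤y y≤x))

  -- With `y = x + d` the two sides differ by `d * d`.
  x≤y⇒xy+xy≤x²+y² : ∀ {x y} → x ≤ y → x * y + x * y ≤ x * x + y * y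
  x≤y⇒xy+xy≤x²+y² {x} {y} x≤y with d , 0≤d , x+d≈y ← ≤⇒∃+ x≤y = begin
    x * y + x * y                       ≈⟨ +-cong (*-congˡ x+d≈y) (*-congˡ x+d≈y) ⟨
    x * (x + d) + x * (x + d)           ≤⟨ x≤x+y _ (*-nonneg 0≤d 0≤d) ⟩
    x * (x + d) + x * (x + d) + d * d   ≈⟨ solve 2 (λ x d → x :* (x :+ d) :+ x :* (x :+ d) :+ d :* d
                                             := x :* x :+ (x :+ d) :* (x :+ d)) refl x d ⟩
    x * x + (x + d) * (x + d)           ≈⟨ +-congˡ (*-cong x+d≈y x+d≈y) ⟩
    x * x + y * y                       ∎

  xy+xy≤x²+y² : ∀ x y → x * y + x * y ≤ x * x + y * y
  xy+xy≤x²+y² x y with ≤-total x y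
  ... | inj₁ x≤y = x≤y⇒xy+xy≤x²+y² x≤y
  ... | inj₂ y≤x = begin
    x * y + x * y   ≈⟨ +-cong (*-comm x y) (*-comm x y) ⟩
    y * x + y * x   ≤⟨ x≤y⇒xy+xy≤x²+y² y≤x ⟩
    y * y + x * x   ≈⟨ +-comm (y * y) (x * x) ⟩
    x * x + y * y   ∎

  -- The difference of the two sides is (s l − y)² plus nonnegative terms.
  balance : ∀ {s l y} → 0# ≤ s → 0# ≤ l → 0# ≤ y →
            s * ((l + y) * (1# + (l + y)))
              ≤ 2# * (s * (1# + s)) * (l * (1# + l)) + (1# + s) * (y * (1# + y))
  balance {s} {l} {y} 0≤s 0≤l 0≤y = begin
    s * ((l + y) * (1# + (l + y)))
      ≈⟨ solve 3 (λ s l y → s :* ((l :+ y) :* (con 1 :+ (l :+ y)))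
           := ((s :* l) :* y :+ (s :* l) :* y) :+ (s :* (l :* l) :+ s :* (y :* y) :+ s :* l :+ s :* y)) refl s l y ⟩
    ((s * l) * y + (s * l) * y) + rest
      ≤⟨ +-monoˡ-≤ _ (xy+xy≤x²+y² (s * l) y) ⟩
    ((s * l) * (s * l) + y * y) + rest
      ≤⟨ x≤x+y _ (+-nonneg (+-nonneg (+-nonneg (+-nonneg 0≤sl² (*-nonneg 0≤s 0≤sl²))
                     (*-nonneg 0≤s (*-nonneg 0≤s 0≤l)))
                     (*-nonneg 0≤s (*-nonneg 0≤s 0≤l))) (+-nonneg (*-nonneg 0≤s 0≤l) 0≤y)) ⟩
    ((s * l) * (s * l) + y * y) + rest
      + (s * (l * l) + s * (s * (l * l)) + s * (s * l) + s * (s * l) + (s * l + y))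
      ≈⟨ solve 3 (λ s l y →
           ((s :* l) :* (s :* l) :+ y :* y) :+ (s :* (l :* l) :+ s :* (y :* y) :+ s :* l :+ s :* y)
             :+ (s :* (l :* l) :+ s :* (s :* (l :* l)) :+ s :* (s :* l) :+ s :* (s :* l) :+ (s :* l :+ y))
           := (con 1 :+ con 1) :* (s :* (con 1 :+ s)) :* (l :* (con 1 :+ l)) :+ (con 1 :+ s) :* (y :* (con 1 :+ y)))
           refl s l y ⟩
    2# * (s * (1# + s)) * (l * (1# + l)) + (1# + s) * (y * (1# + y)) ∎
    where
    rest = s * (l * l) + s * (y * y) + s * l + s * y
    0≤sl² = *-nonneg 0≤s (*-nonneg 0≤l 0≤l)

  -- Natural numbers in the field, and finite sums.

  fromℕ-homo-+ : ∀ m n → fromℕ (m ℕ.+ n) ≈ fromℕ m + fromℕ n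
  fromℕ-homo-+ = ×-homo-+ 1#

  fromℕ-homo-* : ∀ m n → fromℕ (m ℕ.* n) ≈ fromℕ m * fromℕ n
  fromℕ-homo-* = ×1-homo-*

  fromℕ-nonneg : ∀ n → 0# ≤ fromℕ n
  fromℕ-nonneg zero    = ≤-refl
  fromℕ-nonneg (suc n) = +-nonneg 0≤1 (fromℕ-nonneg n)

  fromℕ-pos : ∀ n → 0# < fromℕ (suc n)
  fromℕ-pos n = <-≤-trans 0<1 (x≤x+y 1# (fromℕ-nonneg n))

  fromℕ-mono-≤ : ∀ {m n} → m ℕ.≤ n → fromℕ m ≤ fromℕ n
  fromℕ-mono-≤ {n = n} z≤n = fromℕ-nonneg n
  fromℕ-mono-≤ (s≤s m≤n)   = +-monoʳ-≤ 1# (fromℕ-mono-≤ m≤n)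

  ∑-nonneg : ∀ {n} (f : Fin n → Carrier) → (∀ i → 0# ≤ f i) → 0# ≤ ∑[ i < n ] f i
  ∑-nonneg {zero}  f 0≤f = ≤-refl
  ∑-nonneg {suc n} f 0≤f = +-nonneg (0≤f zero) (∑-nonneg (f ∘ suc) (0≤f ∘ suc))

  ∑-lowerBound : ∀ {n} (f : Fin n → Carrier) {b} → (∀ i → b ≤ f i) → fromℕ n * b ≤ ∑[ i < n ] f i
  ∑-lowerBound {zero}  f {b} b≤f = ≤-reflexive (zeroˡ b)
  ∑-lowerBound {suc n} f {b} b≤f = begin
    (1# + fromℕ n) * b          ≈⟨ distribʳ b 1# (fromℕ n) ⟩
    1# * b + fromℕ n * b        ≈⟨ +-congʳ (*-identityˡ b) ⟩
    b + fromℕ n * b             ≤⟨ +-mono-≤ (b≤f zero) (∑-lowerBound (f ∘ suc) (b≤f ∘ suc)) ⟩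
    f zero + sum (f ∘ suc)      ∎

  ∑-mono-≤ : ∀ (g : ℕ → Carrier) → (∀ t → 0# ≤ g t) → ∀ {m n} → m ℕ.≤ n →
             ∑[ t < m ] g (toℕ t) ≤ ∑[ t < n ] g (toℕ t)
  ∑-mono-≤ g 0≤g {n = n} z≤n = ∑-nonneg {n} (g ∘ toℕ) (0≤g ∘ toℕ)
  ∑-mono-≤ g 0≤g (s≤s m≤n)   = +-monoʳ-≤ (g 0) (∑-mono-≤ (g ∘ suc) (0≤g ∘ suc) m≤n)

  -- Sums unfold by computation at the first term only; `∑≤middle` has to strip a sum from both
  -- ends.
  ∑-last : ∀ (g : ℕ → Carrier) n →
           ∑[ t < suc n ] g (toℕ t) ≈ ∑[ t < n ] g (toℕ t) + g n
  ∑-last g zero    = +-comm (g 0) 0#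
  ∑-last g (suc n) = trans (+-congˡ (∑-last (g ∘ suc) n)) (sym (+-assoc _ _ _))

  -- Discretely concave sequences.

  module Concave where

    Concave : (ℕ → Carrier) → Set ℓ₂
    Concave g = ∀ t → g (2 ℕ.+ t) + g t ≤ g (1 ℕ.+ t) + g (1 ℕ.+ t)

    -- Increments never grow, so the one at `n` is at most the one at 0. To avoid subtraction, the
    -- induction adds the concavity inequality at `n` and cancels `g n + g (suc n)`.
    contract : ∀ g → Concave g → ∀ n → g (suc n) + g 0 ≤ g n + g 1
    contract g conc zero    = ≤-reflexive (+-comm (g 1) (g 0))
    contract g conc (suc n) = +-cancelʳ-≤ (g n + g (suc n)) (begin
      (g₂ + g 0) + (g n + g₁)      ≈⟨ solve 4 (λ a b c d → (a :+ d) :+ (c :+ b) := (a :+ c) :+ (b :+ d))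
                                       refl g₂ g₁ (g n) (g 0) ⟩
      (g₂ + g n) + (g₁ + g 0)      ≤⟨ +-mono-≤ (conc n) (contract g conc n) ⟩
      (g₁ + g₁) + (g n + g 1)      ≈⟨ solve 3 (λ b c d → (b :+ b) :+ (c :+ d) := (b :+ d) :+ (c :+ b))
                                       refl g₁ (g n) (g 1) ⟩
      (g₁ + g 1) + (g n + g₁)      ∎)
      where
      g₁ = g (suc n)
      g₂ = g (suc (suc n))

    -- `contract` moves the outer pair of indices from 0 and 2j to 1 and 2j - 1; the induction
    -- continues with the shifted sequence `g ∘ suc`, which is again concave.
    midpoint : ∀ g → Concave g → ∀ j → g (j ℕ.+ j) + g 0 ≤ g j + g j
    midpoint g conc zero    = ≤-refl
    midpoint g conc (suc j) rewrite ℕ.+-suc j j = begin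
      g (2 ℕ.+ (j ℕ.+ j)) + g 0   ≤⟨ contract g conc (suc (j ℕ.+ j)) ⟩
      g (1 ℕ.+ (j ℕ.+ j)) + g 1   ≤⟨ midpoint (g ∘ suc) (conc ∘ suc) j ⟩
      g (suc j) + g (suc j)       ∎

    -- The 2j + 1 indices lie symmetrically about j, and by `midpoint` two terms equally far from
    -- the centre sum to at most twice `g j`. The induction strips the outermost pair.
    ∑≤middle : ∀ g → Concave g → ∀ j →
               ∑[ t < suc (j ℕ.+ j) ] g (toℕ t) ≤ (1# + (fromℕ j + fromℕ j)) * g j
    ∑≤middle g conc zero = ≤-reflexive
      (solve 1 (λ x → x :+ con 0 := (con 1 :+ (con 0 :+ con 0)) :* x) refl (g 0))
    ∑≤middle g conc (suc j) rewrite ℕ.+-suc j j = begin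
      g 0 + ∑[ t < 2 ℕ.+ (j ℕ.+ j) ] g (suc (toℕ t))
        ≈⟨ +-congˡ (∑-last (g ∘ suc) (suc (j ℕ.+ j))) ⟩
      g 0 + (∑[ t < suc (j ℕ.+ j) ] g (suc (toℕ t)) + g (2 ℕ.+ (j ℕ.+ j)))
        ≈⟨ solve 3 (λ a b c → a :+ (b :+ c) := (c :+ a) :+ b) refl _ _ _ ⟩
      (g (2 ℕ.+ (j ℕ.+ j)) + g 0) + ∑[ t < suc (j ℕ.+ j) ] g (suc (toℕ t))
        ≤⟨ +-mono-≤ (≡.subst (λ n → g (suc n) + g 0 ≤ g (suc j) + g (suc j)) (ℕ.+-suc j j)
                       (midpoint g conc (suc j)))
                    (∑≤middle (g ∘ suc) (conc ∘ suc) j) ⟩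
      (g (suc j) + g (suc j)) + (1# + (fromℕ j + fromℕ j)) * g (suc j)
        ≈⟨ solve 2 (λ x n → (x :+ x) :+ (con 1 :+ (n :+ n)) :* x
                     := (con 1 :+ ((con 1 :+ n) :+ (con 1 :+ n))) :* x) refl (g (suc j)) (fromℕ j) ⟩
      (1# + (fromℕ (suc j) + fromℕ (suc j))) * g (suc j) ∎

    -- The ratio `g t / t` does not increase; multiplying out the denominators lets the induction
    -- start at 0. The step adds concavity, weighted by `fromℕ (suc t)`, to the previous inequality.
    slope-step : ∀ g → Concave g → 0# ≤ g 0 → ∀ t → fromℕ t * g (suc t) ≤ fromℕ (suc t) * g t
    slope-step g conc 0≤g₀ zero = begin
      0# * g 1          ≈⟨ zeroˡ (g 1) ⟩
      0#                ≤⟨ *-nonneg (fromℕ-nonneg 1) 0≤g₀ ⟩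
      fromℕ 1 * g 0     ∎
    slope-step g conc 0≤g₀ (suc t) = +-cancelʳ-≤ (n′ * g t + n * g₁) (begin
      n′ * g₂ + (n′ * g t + n * g₁)     ≈⟨ solve 5 (λ n′ n a b c → n′ :* a :+ (n′ :* c :+ n :* b)
                                              := n′ :* (a :+ c) :+ n :* b) refl n′ n g₂ g₁ (g t) ⟩
      n′ * (g₂ + g t) + n * g₁          ≤⟨ +-mono-≤ (*-monoʳ-≤ (fromℕ-nonneg (suc t)) (conc t))
                                                   (slope-step g conc 0≤g₀ t) ⟩
      n′ * (g₁ + g₁) + n′ * g t         ≈⟨ solve 3 (λ n b c → (con 1 :+ n) :* (b :+ b) :+ (con 1 :+ n) :* c
                                              := (con 1 :+ (con 1 :+ n)) :* b :+ ((con 1 :+ n) :* c :+ n :* b))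
                                              refl n g₁ (g t) ⟩
      (1# + n′) * g₁ + (n′ * g t + n * g₁) ∎)
      where
      n = fromℕ t
      n′ = fromℕ (suc t)
      g₁ = g (suc t)
      g₂ = g (suc (suc t))

    slope : ∀ g → Concave g → 0# ≤ g 0 → ∀ {s t} → s ℕ.≤ t → fromℕ s * g t ≤ fromℕ t * g s
    slope g conc 0≤g₀ {s} s≤t = go (ℕ.≤⇒≤′ s≤t)
      where
      go : ∀ {t} → s ℕ.≤′ t → fromℕ s * g t ≤ fromℕ t * g s
      go (ℕ.≤′-reflexive ≡.refl) = ≤-refl
      -- Passing through the intermediate index `t` requires cancelling `fromℕ t`, which fails at 0;
      -- there `s` is 0 too, and a single `slope-step` suffices.
      go {suc zero} (ℕ.≤′-step s≤0) with ≡.refl ← ℕ.n≤0⇒n≡0 (ℕ.≤′⇒≤ s≤0) = slope-step g conc 0≤g₀ 0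
      go {suc t@(suc t-1)} (ℕ.≤′-step s≤t) = *-cancelʳ-≤ (fromℕ-pos t-1) (begin
        fromℕ s * g (suc t) * n       ≈⟨ *-assoc _ _ _ ⟩
        fromℕ s * (g (suc t) * n)     ≈⟨ *-congˡ (*-comm _ _) ⟩
        fromℕ s * (n * g (suc t))     ≤⟨ *-monoʳ-≤ (fromℕ-nonneg s) (slope-step g conc 0≤g₀ t) ⟩
        fromℕ s * (fromℕ (suc t) * g t)  ≈⟨ solve 3 (λ a b c → a :* (b :* c) := b :* (a :* c)) refl _ _ _ ⟩
        fromℕ (suc t) * (fromℕ s * g t)  ≤⟨ *-monoʳ-≤ (fromℕ-nonneg (suc t)) (go s≤t) ⟩
        fromℕ (suc t) * (n * g s)        ≈⟨ solve 3 (λ a b c → a :* (b :* c) := a :* c :* b) refl _ _ _ ⟩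
        fromℕ (suc t) * g s * n          ∎)
        where n = fromℕ t

-- Total weight and expectation of finite distributions.

module Expectation {c ℓ₁ ℓ₂} (𝔽 : EuclideanField c ℓ₁ ℓ₂) where
  open EuclideanField 𝔽
  open OrderedField 𝔽
  open Probability 𝔽
  open import Relation.Binary.Reasoning.Setoid setoid

  private
    variable
      a b : Level
      A : Set a
      B : Set b

  scale : Carrier → Dist A → Dist A
  scale p = List.map (λ (q , y) → p * q , y)

  -- `Dist` allows arbitrary weights, so their total must be shown to be one before a constant can
  -- be taken out of an expectation.
  mass : Dist A → Carrier
  mass = List.foldr (λ (p , _) e → p + e) 0#

  expectation-++ : ∀ d e → expectation (d ++ e) ≈ expectation d + expectation e
  expectation-++ []            e = sym (+-identityˡ _)
  expectation-++ ((p , x) ∷ d) e = trans (+-congˡ (expectation-++ d e)) (sym (+-assoc _ _ _))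

  expectation-scale : ∀ p d → expectation (scale p d) ≈ p * expectation d
  expectation-scale p []            = sym (zeroʳ p)
  expectation-scale p ((q , x) ∷ d) = begin
    p * q * x + expectation (scale p d)  ≈⟨ +-congˡ (expectation-scale p d) ⟩
    p * q * x + p * expectation d        ≈⟨ solve 4 (λ p q x e → p :* q :* x :+ p :* e := p :* (q :* x :+ e))
                                              refl p q x (expectation d) ⟩
    p * (q * x + expectation d)          ∎

  mass-++ : ∀ (d e : Dist A) → mass (d ++ e) ≈ mass d + mass e
  mass-++ []            e = sym (+-identityˡ _)
  mass-++ ((p , x) ∷ d) e = trans (+-congˡ (mass-++ d e)) (sym (+-assoc _ _ _))

  mass-scale : ∀ p (d : Dist A) → mass (scale p d) ≈ p * mass d
  mass-scale p []            = sym (zeroʳ p)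
  mass-scale p ((q , x) ∷ d) = trans (+-congˡ (mass-scale p d)) (sym (distribˡ p q (mass d)))

  mass->>= : ∀ (d : Dist A) (g : A → Dist B) → (∀ x → mass (g x) ≈ 1#) → mass (d >>= g) ≈ mass d
  mass->>= []            g mass≈1 = refl
  mass->>= ((p , x) ∷ d) g mass≈1 = begin
    mass (scale p (g x) ++ (d >>= g))        ≈⟨ mass-++ (scale p (g x)) _ ⟩
    mass (scale p (g x)) + mass (d >>= g)    ≈⟨ +-cong (mass-scale p (g x)) (mass->>= d g mass≈1) ⟩
    p * mass (g x) + mass d                  ≈⟨ +-congʳ (*-congˡ (mass≈1 x)) ⟩
    p * 1# + mass d                          ≈⟨ +-congʳ (*-identityʳ p) ⟩
    p + mass d                               ∎

  mass-return : ∀ (x : A) → mass (return x) ≈ 1#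
  mass-return x = +-identityʳ 1#

  mass-uniform : ∀ n → mass (uniform (suc n)) ≈ 1#
  mass-uniform n = begin
    mass (uniform (suc n))        ≈⟨ mass-tabulate (suc n) id ⟩
    fromℕ (suc n) * w             ≈⟨ *-congˡ (*-identityˡ _) ⟩
    fromℕ (suc n) / fromℕ (suc n) ≈⟨ x*x⁻¹≈1 (fromℕ-pos n) ⟩
    1#                            ∎
    where
    w = 1# / fromℕ (suc n)
    -- The tail of `allFin` is not an `allFin`, hence the induction over an arbitrary tabulated `h`
    -- with the weight `w` kept fixed.
    mass-tabulate : ∀ l (h : Fin l → A) →
                    mass (List.map (λ j → w , j) (List.tabulate h)) ≈ fromℕ l * w
    mass-tabulate zero    h = sym (zeroˡ w)
    mass-tabulate (suc l) h = begin
      w + mass (List.map (λ j → w , j) (List.tabulate (h ∘ suc)))  ≈⟨ +-congˡ (mass-tabulate l (h ∘ suc)) ⟩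
      w + fromℕ l * w                  ≈⟨ solve 2 (λ w l → w :+ l :* w := (con 1 :+ l) :* w) refl w (fromℕ l) ⟩
      fromℕ (suc l) * w                ∎

  expectation->>=-cons : ∀ p (x : A) d (g : A → Dist Carrier) →
    expectation (((p , x) ∷ d) >>= g) ≈ p * expectation (g x) + expectation (d >>= g)
  expectation->>=-cons p x d g =
    trans (expectation-++ (scale p (g x)) _) (+-congʳ (expectation-scale p (g x)))

  -- Linearity of expectation, where the constant `x` is counted with the total weight of `d`.
  expectation-shift : ∀ x d → expectation (d >>= λ y → return (x + y)) ≈ x * mass d + expectation d
  expectation-shift x []            = solve 1 (λ x → con 0 := x :* con 0 :+ con 0) refl x
  expectation-shift x ((p , y) ∷ d) = begin
    expectation (((p , y) ∷ d) >>= λ y → return (x + y))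
      ≈⟨ expectation->>=-cons p y d (λ y → return (x + y)) ⟩
    p * (1# * (x + y) + 0#) + expectation (d >>= λ y → return (x + y))
      ≈⟨ +-congˡ (expectation-shift x d) ⟩
    p * (1# * (x + y) + 0#) + (x * mass d + expectation d)
      ≈⟨ solve 5 (λ p x y m e → p :* (con 1 :* (x :+ y) :+ con 0) :+ (x :* m :+ e)
                    := x :* (p :+ m) :+ (p :* y :+ e)) refl p x y (mass d) (expectation d) ⟩
    x * (p + mass d) + (p * y + expectation d) ∎

  expectation-uniform : ∀ n (g : Fin n → Dist Carrier) →
    expectation (uniform n >>= g) ≈ 1# / fromℕ n * ∑[ j < n ] expectation (g j)
  expectation-uniform n g = go n id
    where
    w = 1# / fromℕ n
    go : ∀ l (h : Fin l → Fin n) →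
         expectation (List.map (λ j → w , j) (List.tabulate h) >>= g) ≈ w * ∑[ j < l ] expectation (g (h j))
    go zero    h = sym (zeroʳ w)
    go (suc l) h = begin
      expectation (List.map (λ j → w , j) (List.tabulate h) >>= g)
        ≈⟨ expectation->>=-cons w (h zero) (List.map (λ j → w , j) (List.tabulate (h ∘ suc))) g ⟩
      w * expectation (g (h zero)) + expectation (List.map (λ j → w , j) (List.tabulate (h ∘ suc)) >>= g)
        ≈⟨ +-congˡ (go l (h ∘ suc)) ⟩
      w * expectation (g (h zero)) + w * (∑[ j < l ] expectation (g (h (suc j))))
        ≈⟨ distribˡ w _ _ ⟨
      w * (expectation (g (h zero)) + (∑[ j < l ] expectation (g (h (suc j))))) ∎

-- A single arm: pulls made and reward collected.

module RoundRobin {c ℓ₁ ℓ₂} (𝔽 : EuclideanField c ℓ₁ ℓ₂) {k : ℕ} (I : ImprovingBandits 𝔽 k)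
                  (m : EuclideanField.Carrier 𝔽) (τ : ℕ) where
  open EuclideanField 𝔽
  open OrderedField 𝔽
  open Concave
  open Probability 𝔽
  open Expectation 𝔽
  open ImprovingBandits I
  open Bandits 𝔽 I
  open RandomRoundRobin m τ
  open Algebra.Properties.Semiring.Sum semiring using (sum; sum-remove; sum-cong-≋; *-distribˡ-sum)
  open Relation.Binary.Reasoning.PartialOrder poset

  Passes : Fin k → ℕ → Set ℓ₂
  Passes i t = (m * fromℕ t) / fromℕ τ ≤ reward i t

  pullsLeft : Fin k → ℕ → ℕ → ℕ
  pullsLeft i t n = proj₁ (play i t n)

  gain : Fin k → ℕ → ℕ → Carrier
  gain i t n = proj₂ (play i t n)

  gain-nonneg : ∀ i t n → 0# ≤ gain i t n
  gain-nonneg i t zero    = ≤-refl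
  gain-nonneg i t (suc n) with (m * fromℕ t) / fromℕ τ ≤? reward i t
  ... | no  _ = ≤-refl
  ... | yes _ = +-nonneg (nonneg i (suc t)) (gain-nonneg i (suc t) n)

  -- Twice the sum of the s < t, and 0 at t = 0.
  Δ : ℕ → ℕ
  Δ t = ℕ.pred t ℕ.* t

  Δ-suc : ∀ t → fromℕ (Δ (suc t)) ≈ fromℕ t + fromℕ t + fromℕ (Δ t)
  Δ-suc zero    = sym (trans (+-identityʳ _) (+-identityˡ 0#))
  Δ-suc (suc t) = begin-equality
    fromℕ (suc t ℕ.* suc (suc t))                ≈⟨ fromℕ-homo-* (suc t) (suc (suc t)) ⟩
    (1# + fromℕ t) * (1# + (1# + fromℕ t))       ≈⟨ solve 1 (λ t → (con 1 :+ t) :* (con 1 :+ (con 1 :+ t))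
                                                     := (con 1 :+ t) :+ (con 1 :+ t) :+ t :* (con 1 :+ t))
                                                     refl (fromℕ t) ⟩
    fromℕ (suc t) + fromℕ (suc t) + fromℕ t * fromℕ (suc t)
                                                 ≈⟨ +-congˡ (fromℕ-homo-* t (suc t)) ⟨
    fromℕ (suc t) + fromℕ (suc t) + fromℕ (t ℕ.* suc t) ∎

  θ : Carrier
  θ = m / fromℕ τ

  -- `l` counts the pulls made. A pull at counter `t` follows a passed test, so by monotonicity it
  -- pays at least `θ * fromℕ t`; adding these up telescopes in `Δ`. The initial `Δ t` stands on the
  -- right to avoid subtraction.
  play-pulls : ∀ i t n → ∃[ l ] n ≡ l ℕ.+ pullsLeft i t n ×
               θ * fromℕ (Δ (l ℕ.+ t)) ≤ 2# * gain i t n + θ * fromℕ (Δ t)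
  play-pulls i t zero = 0 , ≡.refl , x≤y+x _ (≤-reflexive (sym (zeroʳ 2#)))
  play-pulls i t (suc n) with (m * fromℕ t) / fromℕ τ ≤? reward i t
  ... | no  _ = 0 , ≡.refl , x≤y+x _ (≤-reflexive (sym (zeroʳ 2#)))
  ... | yes passes with l , n≡ , bound ← play-pulls i (suc t) n =
    suc l , ≡.cong suc n≡ , (begin
      θ * fromℕ (Δ (suc (l ℕ.+ t)))             ≡⟨ ≡.cong (λ u → θ * fromℕ (Δ u)) (ℕ.+-suc l t) ⟨
      θ * fromℕ (Δ (l ℕ.+ suc t))               ≤⟨ bound ⟩
      2# * x + θ * fromℕ (Δ (suc t))            ≈⟨ +-congˡ (*-congˡ (Δ-suc t)) ⟩
      2# * x + θ * (fromℕ t + fromℕ t + D)      ≈⟨ solve 4 (λ x h t d → (con 1 :+ con 1) :* x :+ h :* (t :+ t :+ d)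
                                                      := (con 1 :+ con 1) :* (h :* t :+ x) :+ h :* d) refl x θ (fromℕ t) D ⟩
      2# * (θ * fromℕ t + x) + θ * D            ≤⟨ +-monoˡ-≤ _ (*-monoʳ-≤ (+-nonneg 0≤1 0≤1) (+-monoˡ-≤ x θt≤)) ⟩
      2# * (reward i (suc t) + x) + θ * D       ∎)
    where
    x = gain i (suc t) n
    D = fromℕ (Δ t)
    θt≤ : θ * fromℕ t ≤ reward i (suc t)
    θt≤ = begin
      θ * fromℕ t               ≈⟨ solve 3 (λ m i t → m :* i :* t := m :* t :* i) refl m (fromℕ τ ⁻¹) (fromℕ t) ⟩
      (m * fromℕ t) / fromℕ τ   ≤⟨ passes ⟩
      reward i t                ≤⟨ nondecreasing i (ℕ.n≤1+n t) ⟩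
      reward i (suc t)          ∎

  pullsLeft≤ : ∀ i t n → pullsLeft i t n ℕ.≤ n
  pullsLeft≤ i t n with l , n≡ , _ ← play-pulls i t n =
    ≡.subst (pullsLeft i t n ℕ.≤_) (≡.sym n≡) (ℕ.m≤n+m _ l)

  -- Either the budget runs out, or a test fails; in the second case the counter `l + t` reached by
  -- then must exceed `u`.
  play-persists : ∀ i u → (∀ t → t ℕ.≤ u → Passes i t) → ∀ t n l → n ≡ l ℕ.+ pullsLeft i t n →
                  pullsLeft i t n ≡ 0 ⊎ suc u ℕ.≤ l ℕ.+ t
  play-persists i u passes t zero    l n≡ = inj₁ ≡.refl
  play-persists i u passes t (suc n) l n≡ with (m * fromℕ t) / fromℕ τ ≤? reward i t
  play-persists i u passes t (suc n) l       n≡ | no  fails =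
    inj₂ (ℕ.≤-trans (ℕ.≰⇒> (fails ∘ passes t)) (ℕ.m≤n+m t l))
  -- A pull has just been made, so the number `l` of pulls used cannot be 0.
  play-persists i u passes t (suc n) zero    n≡ | yes _ =
    contradiction (≡.subst (ℕ._≤ n) (≡.sym n≡) (pullsLeft≤ i (suc t) n)) ℕ.1+n≰n
  play-persists i u passes t (suc n) (suc l) n≡ | yes _
    with play-persists i u passes (suc t) n l (ℕ.suc-injective n≡)
  ... | inj₁ left≡0 = inj₁ left≡0
  ... | inj₂ u<l+1+t = inj₂ (≡.subst (suc u ℕ.≤_) (ℕ.+-suc l t) u<l+1+t)

  -- As the test at 0 passes, at least one pull is made, and `l` is the number of pulls minus one.
  -- The tests passed have counters 0 to l, and twice their sum is `l * suc l`.
  pulls-suc : ∀ i → Passes i 0 → ∀ n → ∃[ l ] n ≡ l ℕ.+ pullsLeft i 0 (suc n) ×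
              θ * fromℕ (l ℕ.* suc l) ≤ 2# * gain i 0 (suc n)
  pulls-suc i passes n with play-pulls i 0 (suc n)
  ... | zero  , n≡ , _ with play-persists i 0 (λ { _ z≤n → passes }) 0 (suc n) 0 n≡
  ...   | inj₁ left≡0 = contradiction (≡.trans n≡ left≡0) (λ ())
  pulls-suc i passes n | suc l , n≡ , bound = l , ℕ.suc-injective n≡ , (begin
    θ * fromℕ (l ℕ.* suc l)                    ≡⟨ ≡.cong (λ u → θ * fromℕ (ℕ.pred u ℕ.* u)) (ℕ.+-identityʳ (suc l)) ⟨
    θ * fromℕ (Δ (suc l ℕ.+ 0))                ≤⟨ bound ⟩
    2# * gain i 0 (suc n) + θ * 0#             ≈⟨ +-congˡ (zeroʳ θ) ⟩
    2# * gain i 0 (suc n) + 0#                 ≈⟨ +-identityʳ _ ⟩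
    2# * gain i 0 (suc n)                      ∎)

  -- Either the budget is used up, so that `l` equals `n`, or the counter has passed `u`; both make
  -- `l` at least `x`.
  persistent-gain : ∀ i u → (∀ t → t ℕ.≤ u → Passes i t) → 0# ≤ θ → ∀ n x → x ℕ.≤ n → x ℕ.≤ u →
                    θ * fromℕ (x ℕ.* suc x) ≤ 2# * gain i 0 (suc n)
  persistent-gain i u passes 0≤θ n x x≤n x≤u with l , n≡ , bound ← pulls-suc i (passes 0 z≤n) n =
    ≤-trans (*-monoʳ-≤ 0≤θ (fromℕ-mono-≤ (ℕ.*-mono-≤ x≤l (s≤s x≤l)))) bound
    where
    x≤l : x ℕ.≤ l
    x≤l with play-persists i u passes 0 (suc n) (suc l) (≡.cong suc n≡)
    ... | inj₁ left≡0 = ≡.subst (x ℕ.≤_) (≡.trans n≡ (≡.trans (≡.cong (l ℕ.+_) left≡0) (ℕ.+-identityʳ l))) x≤n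
    ... | inj₂ u<l+0  = ℕ.≤-trans x≤u (ℕ.≤-pred (≡.subst (suc u ℕ.≤_) (ℕ.+-identityʳ (suc l)) u<l+0))

  -- Expected reward as an average over the next arm.

  afterArm : ∀ n {r} → Vec (Fin k) (suc r) → Fin (suc r) → Dist Carrier
  afterArm n arms j = run (pullsLeft (lookup arms j) 0 (suc n)) (removeAt arms j)

  -- Turns the weight factor of `expectation-shift` into one, so that the gain of the chosen arm is
  -- simply added to the expected reward afterwards.
  mass-run : ∀ n {r} (arms : Vec (Fin k) r) → mass (run n arms) ≈ 1#
  mass-run zero    []           = mass-return 0#
  mass-run (suc n) []           = mass-return 0#
  mass-run zero    (_ ∷ _)      = mass-return 0#
  mass-run (suc n) {suc r} arms@(_ ∷ _) = trans
    (mass->>= (uniform (suc r)) (λ j → afterArm n arms j >>= collect j) λ j → trans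
      (mass->>= (afterArm n arms j) (collect j) λ y → mass-return (gain (lookup arms j) 0 (suc n) + y))
      (mass-run (pullsLeft (lookup arms j) 0 (suc n)) (removeAt arms j)))
    (mass-uniform r)
    where
    collect : Fin (suc r) → Carrier → Dist Carrier
    collect j y = return (gain (lookup arms j) 0 (suc n) + y)

  armValue : ∀ n {r} → Vec (Fin k) (suc r) → Fin (suc r) → Carrier
  armValue n arms j = gain (lookup arms j) 0 (suc n) + expectation (afterArm n arms j)

  expectation-run : ∀ n {r} (arms : Vec (Fin k) (suc r)) →
    expectation (run (suc n) arms) ≈ 1# / fromℕ (suc r) * ∑[ j < suc r ] armValue n arms j
  expectation-run n {r} arms@(_ ∷ _) = trans
    (expectation-uniform (suc r) λ j → afterArm n arms j >>= λ y → return (gain (lookup arms j) 0 (suc n) + y))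
    (*-congˡ (sum-cong-≋ λ j → let x = gain (lookup arms j) 0 (suc n) in trans
      (expectation-shift x (afterArm n arms j))
      (+-congʳ (trans (*-congˡ (mass-run _ (removeAt arms j))) (*-identityʳ x)))))

  expectation-return-0 : expectation (return 0#) ≈ 0#
  expectation-return-0 = solve 0 (con 1 :* con 0 :+ con 0 := con 0) refl

  expectation-run-nonneg : ∀ n {r} (arms : Vec (Fin k) r) → 0# ≤ expectation (run n arms)
  expectation-run-nonneg zero    []      = ≤-reflexive (sym expectation-return-0)
  expectation-run-nonneg (suc n) []      = ≤-reflexive (sym expectation-return-0)
  expectation-run-nonneg zero    (_ ∷ _) = ≤-reflexive (sym expectation-return-0)
  expectation-run-nonneg (suc n) {suc r} arms@(_ ∷ _) = begin
    0#                                           ≤⟨ *-nonneg (*-nonneg 0≤1 (⁻¹-nonneg (fromℕ-pos r))) 0≤∑ ⟩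
    1# / fromℕ (suc r) * sum (armValue n arms)   ≈⟨ expectation-run n arms ⟨
    expectation (run (suc n) arms)               ∎
    where
    0≤∑ = ∑-nonneg (armValue n arms) λ j → +-nonneg (gain-nonneg (lookup arms j) 0 (suc n))
      (expectation-run-nonneg (pullsLeft (lookup arms j) 0 (suc n)) (removeAt arms j))

  -- Inequalities for the induction step.

  -- X is the gain from the arm, which takes l + 1 pulls, and V the expected
  -- reward afterwards, bounded inductively.
  opponent-step : ∀ {s X V} l y x → 0# ≤ θ → 0# < s → x ℕ.≤ l ℕ.+ y →
                  θ * fromℕ (l ℕ.* suc l) ≤ 2# * X →
                  θ * fromℕ (y ℕ.* suc y) ≤ 4# * s * V →
                  θ * fromℕ (x ℕ.* suc x) ≤ 4# * (1# + s) * (X + V)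
  opponent-step {s} {X} {V} l y x 0≤θ 0<s@(0≤s , _) x≤l+y X-bound V-bound = *-cancelʳ-≤ 0<s (begin
    θ * fromℕ (x ℕ.* suc x) * s
      ≤⟨ *-monoˡ-≤ 0≤s (*-monoʳ-≤ 0≤θ (fromℕ-mono-≤ (ℕ.*-mono-≤ x≤l+y (s≤s x≤l+y)))) ⟩
    θ * fromℕ ((l ℕ.+ y) ℕ.* suc (l ℕ.+ y)) * s
      ≈⟨ *-congʳ (*-congˡ (trans (fromℕ-homo-* (l ℕ.+ y) _)
           (*-cong (fromℕ-homo-+ l y) (+-congˡ (fromℕ-homo-+ l y))))) ⟩
    θ * ((l′ + y′) * (1# + (l′ + y′))) * s
      ≈⟨ solve 3 (λ a b c → a :* b :* c := a :* (c :* b)) refl θ _ s ⟩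
    θ * (s * ((l′ + y′) * (1# + (l′ + y′))))
      -- `balance` does the minimisation over the split between this arm and the rest. Its
      -- coefficients give both resulting terms the factor `4# * (1# + s) * s`.
      ≤⟨ *-monoʳ-≤ 0≤θ (balance 0≤s (fromℕ-nonneg l) (fromℕ-nonneg y)) ⟩
    θ * (2# * (s * (1# + s)) * (l′ * (1# + l′)) + (1# + s) * (y′ * (1# + y′)))
      ≈⟨ *-congˡ (+-cong (*-congˡ (fromℕ-homo-* l (suc l))) (*-congˡ (fromℕ-homo-* y (suc y)))) ⟨
    θ * (2# * (s * (1# + s)) * fromℕ (l ℕ.* suc l) + (1# + s) * fromℕ (y ℕ.* suc y))
      ≈⟨ solve 5 (λ h a b c d → h :* (a :* b :+ c :* d) := a :* (h :* b) :+ c :* (h :* d)) refl θ _ _ _ _ ⟩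
    2# * (s * (1# + s)) * (θ * fromℕ (l ℕ.* suc l)) + (1# + s) * (θ * fromℕ (y ℕ.* suc y))
      ≤⟨ +-mono-≤ (*-monoʳ-≤ (*-nonneg (+-nonneg 0≤1 0≤1) (*-nonneg 0≤s 0≤1+s)) X-bound)
                  (*-monoʳ-≤ 0≤1+s V-bound) ⟩
    2# * (s * (1# + s)) * (2# * X) + (1# + s) * (4# * s * V)
      ≈⟨ solve 3 (λ s X V → let two = con 1 :+ con 1; four = two :* two in
           two :* (s :* (con 1 :+ s)) :* (two :* X) :+ (con 1 :+ s) :* (four :* s :* V)
             := four :* (con 1 :+ s) :* (X :+ V) :* s) refl s X V ⟩
    4# * (1# + s) * (X + V) * s ∎)
    where
    l′ = fromℕ l
    y′ = fromℕ y
    0≤1+s = +-nonneg 0≤1 0≤s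

  -- As s² = r, the coefficients of `e` on the left of the hypothesis add up to 2(1 + s) + s² = (1 +
  -- s)² + 1. The surplus 1 is dropped, and one factor 1 + s is lowered to √N, since N = 1 + s² is
  -- at most (1 + s)².
  average-step : ∀ {e S} r → 0# ≤ e → let s = √ (fromℕ r); N = fromℕ (suc r) in
                 2# * (1# + s) * e + fromℕ r * e ≤ 4# * (1# + s) * S →
                 e ≤ 4# * √ N * (1# / N * S)
  average-step {e} {S} r 0≤e bound = *-cancelʳ-≤ (*-pos 0<R 0<1+s) (begin
    e * (R * (1# + s))
      ≤⟨ *-monoʳ-≤ 0≤e (*-monoˡ-≤ (proj₁ 0<1+s) R≤1+s) ⟩
    e * ((1# + s) * (1# + s))
      ≤⟨ x≤x+y _ 0≤e ⟩
    e * ((1# + s) * (1# + s)) + e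
      ≈⟨ solve 2 (λ e s → e :* ((con 1 :+ s) :* (con 1 :+ s)) :+ e
           := (con 1 :+ con 1) :* (con 1 :+ s) :* e :+ s :* s :* e) refl e s ⟩
    2# * (1# + s) * e + s * s * e
      ≈⟨ +-congˡ (*-congʳ s²≈r) ⟩
    2# * (1# + s) * e + fromℕ r * e
      ≤⟨ bound ⟩
    4# * (1# + s) * S
      ≈⟨ *-congˡ N*E≈S ⟨
    4# * (1# + s) * (E * N)
      ≈⟨ *-congˡ (*-congˡ R²≈N) ⟨
    4# * (1# + s) * (E * (R * R))
      ≈⟨ solve 4 (λ f t E R → f :* t :* (E :* (R :* R)) := f :* R :* E :* (R :* t)) refl 4# (1# + s) E R ⟩
    4# * R * E * (R * (1# + s)) ∎)
    where
    s = √ (fromℕ r)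
    N = fromℕ (suc r)
    R = √ N
    E = 1# / N * S
    0≤s = √-nonneg (fromℕ-nonneg r)
    0<R = √-pos (fromℕ-pos r)
    0<1+s = <-≤-trans 0<1 (x≤x+y 1# 0≤s)
    s²≈r = √-square (fromℕ-nonneg r)
    R²≈N = √-square (fromℕ-nonneg (suc r))
    N*E≈S : E * N ≈ S
    N*E≈S = begin-equality
      1# / N * S * N     ≈⟨ solve 3 (λ w S N → con 1 :* w :* S :* N := S :* w :* N) refl (N ⁻¹) S N ⟩
      S / N * N          ≈⟨ /-*-cancelʳ S (fromℕ-pos r) ⟩
      S                  ∎
    R≤1+s : R ≤ 1# + s
    R≤1+s = x²≤y²⇒x≤y 0<R (proj₁ 0<1+s) (begin
      R * R                             ≈⟨ R²≈N ⟩
      1# + fromℕ r                      ≈⟨ +-congˡ s²≈r ⟨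
      1# + s * s                        ≤⟨ x≤x+y _ (+-nonneg 0≤s 0≤s) ⟩
      1# + s * s + (s + s)              ≈⟨ solve 1 (λ s → con 1 :+ s :* s :+ (s :+ s)
                                             := (con 1 :+ s) :* (con 1 :+ s)) refl s ⟩
      (1# + s) * (1# + s)               ∎)

  -- Induction on the number of remaining arms.

  module _ (0≤θ : 0# ≤ θ) (passes-0 : ∀ i → Passes i 0)
           (⋆ : Fin k) (passes-⋆ : ∀ t → t ℕ.≤ τ → Passes ⋆ t) where

    -- Each of the r arms left may waste its last pull, so only n ∸ r pulls count.
    run-lowerBound : ∀ n {r} (arms : Vec (Fin k) r) j → lookup arms j ≡ ⋆ → n ℕ.∸ r ℕ.≤ τ →
                     θ * fromℕ ((n ℕ.∸ r) ℕ.* suc (n ℕ.∸ r))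
                       ≤ 4# * √ (fromℕ r) * expectation (run n arms)
    run-lowerBound zero {suc r} arms@(_ ∷ _) j _ _ = begin
      -- With no pulls left the truncated difference is 0, and both sides vanish.
      θ * 0#                                   ≈⟨ zeroʳ θ ⟩
      0#                                       ≈⟨ zeroʳ _ ⟨
      4# * √ (fromℕ (suc r)) * 0#              ≈⟨ *-congˡ expectation-return-0 ⟨
      4# * √ (fromℕ (suc r)) * expectation (return 0#)      ∎
    run-lowerBound (suc n) {suc r} arms j arms[j]≡⋆ x≤τ = begin
      e                                                        ≤⟨ average-step r 0≤e sum-bound ⟩
      4# * √ (fromℕ (suc r)) * (1# / fromℕ (suc r) * sum A)    ≈⟨ *-congˡ (expectation-run n arms) ⟨
      4# * √ (fromℕ (suc r)) * expectation (run (suc n) arms)  ∎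
      where
      x = n ℕ.∸ r
      e = θ * fromℕ (x ℕ.* suc x)
      s = √ (fromℕ r)
      A = armValue n arms
      C = 4# * (1# + s)
      others : Fin r → Carrier
      others i = A (punchIn j i)
      0≤e = *-nonneg 0≤θ (fromℕ-nonneg (x ℕ.* suc x))
      0≤2 = +-nonneg 0≤1 0≤1

      -- Scaling `e ≤ 2# * A j` by 2(1 + s) produces the same factor `C` as for the other arms, so
      -- the optimal arm weighs 2(1 + s) times as much as each of them.
      ⋆-bound : 2# * (1# + s) * e ≤ C * A j
      ⋆-bound = begin
        2# * (1# + s) * e
          ≤⟨ *-monoʳ-≤ (*-nonneg 0≤2 (+-nonneg 0≤1 (√-nonneg (fromℕ-nonneg r)))) e≤2A ⟩
        2# * (1# + s) * (2# * A j)
          ≈⟨ solve 3 (λ two s a → two :* (con 1 :+ s) :* (two :* a) := two :* two :* (con 1 :+ s) :* a) refl 2# s (A j) ⟩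
        C * A j ∎
        where
        X = gain (lookup arms j) 0 (suc n)
        e≤2A : e ≤ 2# * A j
        e≤2A = begin
          e                           ≤⟨ persistent-gain ⋆ τ passes-⋆ 0≤θ n x (ℕ.m∸n≤m n r) x≤τ ⟩
          2# * gain ⋆ 0 (suc n)       ≡⟨ ≡.cong (λ i → 2# * gain i 0 (suc n)) arms[j]≡⋆ ⟨
          2# * X                      ≤⟨ *-monoʳ-≤ 0≤2 (x≤x+y X (expectation-run-nonneg
                                           (pullsLeft (lookup arms j) 0 (suc n)) (removeAt arms j))) ⟩
          2# * A j                    ∎

      other-bound : ∀ i → i ≢ j → e ≤ C * A i
      other-bound i i≢j with l , n≡ , gain≥ ← pulls-suc (lookup arms i) (passes-0 (lookup arms i)) n =
        -- The existence of an arm besides `j` forces `r` to be positive, hence also the `s` that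
        -- `opponent-step` cancels.
        opponent-step l (n′ ℕ.∸ r) x 0≤θ (√-pos (0<fromℕ (punchOut i≢j))) x≤l+y gain≥
          (run-lowerBound n′ (removeAt arms i) (punchOut i≢j)
            (≡.trans (removeAt-punchOut arms i≢j) arms[j]≡⋆)
            (ℕ.≤-trans (ℕ.∸-monoˡ-≤ r n′≤n) x≤τ))
        where
        n′ = pullsLeft (lookup arms i) 0 (suc n)
        0<fromℕ : ∀ {m} → Fin m → 0# < fromℕ m
        0<fromℕ {suc m} _ = fromℕ-pos m
        n′≤n : n′ ℕ.≤ n
        n′≤n = ≡.subst (n′ ℕ.≤_) (≡.sym n≡) (ℕ.m≤n+m n′ l)
        x≤l+y : x ℕ.≤ l ℕ.+ (n′ ℕ.∸ r)
        -- The arm uses `suc l` pulls while the number of arms drops by one, so the excess of pulls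
        -- over arms falls by at most `l`; truncation at 0 only helps.
        x≤l+y = ℕ.m≤n+o⇒m∸n≤o n r (ℕ.≤-trans (ℕ.≤-reflexive n≡) (ℕ.≤-trans
          (ℕ.+-monoʳ-≤ l (ℕ.m≤n+m∸n n′ r))
          (ℕ.≤-reflexive (≡.trans (≡.sym (ℕ.+-assoc l r _)) (≡.trans
            (≡.cong (ℕ._+ (n′ ℕ.∸ r)) (ℕ.+-comm l r)) (ℕ.+-assoc r l _))))))

      sum-bound : 2# * (1# + s) * e + fromℕ r * e ≤ C * sum A
      sum-bound = begin
        2# * (1# + s) * e + fromℕ r * e             ≤⟨ +-mono-≤ ⋆-bound (∑-lowerBound (λ i → C * others i)
                                                         λ i → other-bound (punchIn j i) (punchInᵢ≢i j i)) ⟩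
        C * A j + sum (λ i → C * others i)          ≈⟨ +-congˡ (*-distribˡ-sum C others) ⟨
        C * A j + C * sum others                    ≈⟨ distribˡ C (A j) (sum others) ⟨
        C * (A j + sum others)                      ≈⟨ *-congˡ (sum-remove {i = j} A) ⟨
        C * sum A                                   ∎

  -- Concavity of the rewards and its consequences.

  concave : ∀ i → Concave (reward i)
  concave i t with d , 0≤d , diff+d≈ ← ≤⇒∃+ (diminishing i t) = begin
    g₂ + g₀                         ≤⟨ x≤x+y _ 0≤d ⟩
    g₂ + g₀ + d                     ≈⟨ +-congʳ (+-congʳ (add-sub g₂ g₁)) ⟨
    (g₂ - g₁ + g₁) + g₀ + d         ≈⟨ solve 4 (λ u a b d → (u :+ a) :+ b :+ d := (u :+ d) :+ b :+ a) refl _ _ _ _ ⟩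
    (g₂ - g₁ + d) + g₀ + g₁         ≈⟨ +-congʳ (+-congʳ diff+d≈) ⟩
    (g₁ - g₀) + g₀ + g₁             ≈⟨ +-congʳ (add-sub g₁ g₀) ⟩
    g₁ + g₁                         ∎
    where
    g₀ = reward i t
    g₁ = reward i (1 ℕ.+ t)
    g₂ = reward i (2 ℕ.+ t)
    add-sub : ∀ x y → x - y + y ≈ x
    add-sub x y = trans (+-assoc x (- y) y) (trans (+-congˡ (-‿inverseˡ y)) (+-identityʳ x))

  -- Adding the index 0 and extending the sum to 2τ makes the range symmetric about τ, as `∑≤middle`
  -- requires.
  cumulative-upperBound : ∀ i {T} → T ℕ.≤ τ ℕ.+ τ →
                          cumulative i T ≤ (1# + (fromℕ τ + fromℕ τ)) * reward i τ
  cumulative-upperBound i {T} T≤2τ = begin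
    cumulative i T                                    ≤⟨ x≤y+x _ (nonneg i 0) ⟩
    ∑[ t < suc T ] reward i (toℕ t)                   ≤⟨ ∑-mono-≤ (reward i) (nonneg i) (s≤s T≤2τ) ⟩
    ∑[ t < suc (τ ℕ.+ τ) ] reward i (toℕ t)           ≤⟨ ∑≤middle (reward i) (concave i) τ ⟩
    (1# + (fromℕ τ + fromℕ τ)) * reward i τ           ∎

  -- By `slope`, reward per pull does not increase, so at `t` it is still at least its value at τ,
  -- hence at least m/τ.
  passes-persistently : ∀ i → 0# < fromℕ τ → m ≤ reward i τ → ∀ t → t ℕ.≤ τ → Passes i t
  passes-persistently i 0<τ m≤ t t≤τ = x≤yz⇒x/z≤y 0<τ (begin
    m * fromℕ t              ≤⟨ *-monoˡ-≤ (fromℕ-nonneg t) m≤ ⟩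
    reward i τ * fromℕ t     ≈⟨ *-comm _ _ ⟩
    fromℕ t * reward i τ     ≤⟨ slope (reward i) (concave i) (nonneg i 0) t≤τ ⟩
    fromℕ τ * reward i t     ≈⟨ *-comm _ _ ⟩
    reward i t * fromℕ τ     ∎)

  passes-initially : ∀ i → 0# < fromℕ τ → Passes i 0
  passes-initially i 0<τ = x≤yz⇒x/z≤y 0<τ (begin
    m * 0#                   ≈⟨ zeroʳ m ⟩
    0#                       ≤⟨ *-nonneg (nonneg i 0) (proj₁ 0<τ) ⟩
    reward i 0 * fromℕ τ     ∎)

-- From the inductive bound to the comparison with the optimum.

theorem3p3p4 :
    ∀ {c ℓ₁ ℓ₂} (𝔽 : EuclideanField c ℓ₁ ℓ₂) →
    let open EuclideanField 𝔽 in
    (c₂ : Carrier) → 1# < c₂ →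
    (k T : ℕ) (I : ImprovingBandits 𝔽 k) →
    let open ImprovingBandits I
        open Bandits 𝔽 I
    in
    2 ℕ.* k ℕ.≤ T →
    (⋆ : Fin k) → IsOptimalArm T ⋆ →
    (m : Carrier) →
    (1# / c₂) * reward ⋆ (T ℕ.∸ k) ≤ m → m ≤ reward ⋆ (T ℕ.∸ k) →
    OPT T / (fromℕ 8 * c₂ * √ (fromℕ k)) ≤ RandomRoundRobin.expectedReward m (T ℕ.∸ k) T
-- Having `⋆` in `Fin k` leaves only the case of a successor.
theorem3p3p4 𝔽 c₂ 1<c₂ k@(suc _) T I 2k≤T ⋆ ⋆-optimal m m≥ m≤ =
  x≤yz⇒x/z≤y (*-pos (*-pos (fromℕ-pos 7) 0<c₂) 0<√k) (begin
    OPT T                                    ≈⟨ ⋆-optimal ⟨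
    cumulative ⋆ T                           ≤⟨ cumulative-upperBound ⋆ T≤2τ ⟩
    -- Rounding 2τ + 1 up to 2(τ + 1) supplies the factor τ + 1 of τ(τ + 1).
    (1# + (t + t)) * M                       ≤⟨ x≤y+x _ 0≤M ⟩
    M + (1# + (t + t)) * M                   ≈⟨ solve 2 (λ M t → M :+ (con 1 :+ (t :+ t)) :* M
                                                  := (con 1 :+ con 1) :* (con 1 :+ t) :* M) refl M t ⟩
    2# * (1# + t) * M                        ≤⟨ *-monoʳ-≤ (*-nonneg 0≤2 (fromℕ-nonneg (suc τ))) M≤c₂m ⟩
    2# * (1# + t) * (c₂ * m)                 ≈⟨ solve 4 (λ two n c m → two :* n :* (c :* m) := two :* c :* (n :* m))
                                                  refl 2# (1# + t) c₂ m ⟩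
    2# * c₂ * ((1# + t) * m)                 ≈⟨ *-congˡ (*-congˡ (/-*-cancelʳ m 0<t)) ⟨
    2# * c₂ * ((1# + t) * (m / t * t))       ≈⟨ *-congˡ (solve 3 (λ n h t → n :* (h :* t) := h :* (t :* n))
                                                  refl (1# + t) (m / t) t) ⟩
    2# * c₂ * (m / t * (t * (1# + t)))       ≈⟨ *-congˡ (*-congˡ (fromℕ-homo-* τ (suc τ))) ⟨
    -- The run starts with `T` pulls and `k` arms, so the excess is exactly τ; the factor 4√k gained
    -- here combines with 2c₂ to 8c₂√k.
    2# * c₂ * (m / t * fromℕ (τ ℕ.* suc τ))  ≤⟨ *-monoʳ-≤ (*-nonneg 0≤2 (proj₁ 0<c₂))
                                                  (run-lowerBound 0≤θ (λ i → passes-initially i 0<t) ⋆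
                                                    (passes-persistently ⋆ 0<t m≤)
                                                    T (Vec.allFin k) ⋆ (lookup-allFin ⋆) ℕ.≤-refl) ⟩
    2# * c₂ * (4# * √ fromℕ k * E)           ≈⟨ solve 3 (λ c r E → let two = con 1 :+ con 1 in
                                                  two :* c :* (two :* two :* r :* E)
                                                  := E :* ((con 1 :+ (con 1 :+ (con 1 :+ (con 1 :+ (con 1 :+
                                                       (con 1 :+ (con 1 :+ (con 1 :+ con 0)))))))) :* c :* r))
                                                  refl c₂ (√ fromℕ k) E ⟩
    E * (fromℕ 8 * c₂ * √ fromℕ k)           ∎)
  where
  open EuclideanField 𝔽
  open OrderedField 𝔽
  open ImprovingBandits I
  open Bandits 𝔽 I
  open Relation.Binary.Reasoning.PartialOrder poset
  τ = T ℕ.∸ k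
  open RoundRobin 𝔽 I m τ
  t = fromℕ τ
  M = reward ⋆ τ
  E = RandomRoundRobin.expectedReward m τ T
  0<c₂ = <-≤-trans 0<1 (proj₁ 1<c₂)
  0<√k = √-pos (fromℕ-pos (ℕ.pred k))
  0≤2 = +-nonneg 0≤1 0≤1
  0≤M = nonneg ⋆ τ
  k+k≤T : k ℕ.+ k ℕ.≤ T
  k+k≤T = ≡.subst (λ n → k ℕ.+ n ℕ.≤ T) (ℕ.+-identityʳ k) 2k≤T
  k≤τ : k ℕ.≤ τ
  -- This is what `T` being at least 2k provides: it yields both T ≤ 2τ and τ > 0.
  k≤τ = ℕ.m+n≤o⇒m≤o∸n k k+k≤T
  T≤2τ : T ℕ.≤ τ ℕ.+ τ
  T≤2τ = ℕ.≤-trans (ℕ.m≤n+m∸n T k) (ℕ.+-monoˡ-≤ τ k≤τ)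
  0<t : 0# < t
  0<t = <-≤-trans (fromℕ-pos (ℕ.pred k)) (fromℕ-mono-≤ k≤τ)
  0≤θ : 0# ≤ m / t
  0≤θ = *-nonneg (≤-trans (*-nonneg (*-nonneg 0≤1 (⁻¹-nonneg 0<c₂)) 0≤M) m≥) (⁻¹-nonneg 0<t)
  M≤c₂m : M ≤ c₂ * m
  M≤c₂m = begin
    M                        ≈⟨ /-*-cancelʳ M 0<c₂ ⟨
    M / c₂ * c₂              ≈⟨ solve 3 (λ M i c → M :* i :* c := c :* (con 1 :* i :* M)) refl M (c₂ ⁻¹) c₂ ⟩
    c₂ * (1# / c₂ * M)       ≤⟨ *-monoʳ-≤ (proj₁ 0<c₂) m≥ ⟩
    c₂ * m                   ∎
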